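{- Let $G$ be a finitely generated Abelian group. (i) Given an expressible $(G,H)$-property $P$ (with $H$ a finite Abelian group), together with a system of functional equations witnessing its expressibility, one can construct in finite time a finite Abelian group $H'$, a subset $E'\subset H'$ and a finite set $F\subset G\times H'$ such that $F$ tiles $G\times E'$ if and only if $P$ is satisfiable. (ii) The same holds for an expressible $(G,(H_u)_{u\in\mathcal{U}})$-property $P$. (iii) The same holds for a weakly expressible $(G,(H_u)_{u\in\mathcal{U}})$-property $P$ (given as the existential quantification of an expressible property together with its witnessing system).
   Context: Let $G$ be a finitely generated Abelian group and $H$ a finite Abelian group. A $(G,H)$-property is a subset $P$ of the set of functions $\alpha:G\to H$; it is satisfiable if some $\alpha$ obeys it. $P$ is expressible if there exist a natural number $M$, and for each $i=1,\dots,M$ a natural number $J_i$ and a subset $E'_i\subset H$, and for each $i$ and $j=1,\dots,J_i$ an element $h_{i,j}\in G$ and a subset $E_{i,j}\subset H$, such that $\alpha:G\to H$ obeys $P$ iff for all $i$ and all $x\in G$ the sets $\alpha(x+h_{i,j})+E_{i,j}$, $j=1,\dots,J_i$, are pairwise disjoint with union equal to $E'_i$ (this system is the witnessing system). For a finite family of finite Abelian groups $(H_u)_{u\in\mathcal{U}}$, a $(G,(H_u)_{u\in\mathcal{U}})$-property is a property of tuples $(\alpha_u:G\to H_u)_{u\in\mathcal{U}}$, identified with a $(G,\prod_u H_u)$-property; it is expressible/satisfiable if the corresponding $(G,\prod_uH_u)$-property is. If $P^*$ is a $(G,(H_u)_{u\in\mathcal{U}\uplus\mathcal{U}^*})$-property,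 its existential quantification is the $(G,(H_u)_{u\in\mathcal{U}})$-property $P$ held by $(\alpha_u)_{u\in\mathcal{U}}$ iff some extension $(\alpha_u)_{u\in\mathcal{U}\uplus\mathcal{U}^*}$ obeys $P^*$; $P$ is weakly expressible if it is the existential quantification of an expressible property. A finite set $F$ in an Abelian group tiles a set $E''$ if there is a set $A$ such that the elements $a+f$ ($a\in A,f\in F$) are pairwise distinct with union equal to $E''$. -}

module Defs where

open import Level using (Level; _⊔_; 0ℓ) renaming (suc to lsuc)
open import Data.List.Relation.Unary.Any using (Any)
open import Algebra.Bundles using (AbelianGroup)
open import Data.Nat using (ℕ; zero; suc)
open import Data.Integer using (ℤ; +_; -[1+_])
open import Data.Fin using (Fin)
open import Data.List using (List; foldr; zipWith)
open import Data.Vec using (Vec; toList)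
open import Data.Product using (Σ; ∃; _×_; _,_; proj₁; proj₂)
open import Data.Sum using (_⊎_; inj₁; inj₂; [_,_])
open import Relation.Nullary using (¬_; Dec)
open import Relation.Binary.PropositionalEquality using (_≡_)
open import Function.Bundles using (_⇔_)
import Data.List.Membership.Setoid as SetoidMembership

private
  variable
    a b c d : Level

module _ (G : AbelianGroup a b) where
  open AbelianGroup G

  natMul : ℕ → Carrier → Carrier
  natMul zero    x = ε
  natMul (suc n) x = x ∙ natMul n x

  intMul : ℤ → Carrier → Carrier
  intMul (+ n)      x = natMul n x
  intMul -[1+ n ]   x = (natMul (suc n) x) ⁻¹

  linComb : List ℤ → List Carrier → Carrier
  linComb ns gs = foldr _∙_ ε (zipWith intMul ns gs)

  FinitelyGenerated : Set (a ⊔ b)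
  FinitelyGenerated =
    Σ ℕ λ n → Σ (Vec Carrier n) λ gs →
      ∀ x → Σ (Vec ℤ n) λ ns → x ≈ linComb (toList ns) (toList gs)

  IsFinite : Set (a ⊔ b)
  IsFinite =
    (∀ x y → Dec (x ≈ y)) ×
    Σ (List Carrier) λ enum → ∀ x → SetoidMembership._∈_ setoid x enum

  FinSubset : Set a
  FinSubset = List Carrier

  _∈ₛ_ : Carrier → FinSubset → Set (a ⊔ b)
  x ∈ₛ E = SetoidMembership._∈_ setoid x E

module _ {I : Set} (H : I → AbelianGroup c d) where
  private
    module H i = AbelianGroup (H i)

  ΠGroup : AbelianGroup c d
  ΠGroup = record
    { Carrier = (i : I) → H.Carrier i
    ; _≈_ = λ f g → ∀ i → H._≈_ i (f i) (g i)
    ; _∙_ = λ f g i → H._∙_ i (f i) (g i)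
    ; ε = λ i → H.ε i
    ; _⁻¹ = λ f i → H._⁻¹ i (f i)
    ; isAbelianGroup = record
      { isGroup = record
        { isMonoid = record
          { isSemigroup = record
            { isMagma = record
              { isEquivalence = record
                { refl = λ i → H.refl i
                ; sym = λ p i → H.sym i (p i)
                ; trans = λ p q i → H.trans i (p i) (q i) }
              ; ∙-cong = λ p q i → H.∙-cong i (p i) (q i) }
            ; assoc = λ f g h i → H.assoc i (f i) (g i) (h i) }
          ; identity = (λ f i → proj₁ (H.identity i) (f i))
                     , (λ f i → proj₂ (H.identity i) (f i)) }
        ; inverse = (λ f i → proj₁ (H.inverse i) (f i))
                  , (λ f i → proj₂ (H.inverse i) (f i))
        ; ⁻¹-cong = λ p i → H.⁻¹-cong i (p i) }
      ; comm = λ f g i → H.comm i (f i) (g i) }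
    }

module _ (G : AbelianGroup a b) (H : AbelianGroup c d) where
  private
    module G = AbelianGroup G
    module H = AbelianGroup H

  record System : Set (a ⊔ c) where
    field
      M  : ℕ
      J  : Fin M → ℕ
      E′ : Fin M → FinSubset H
      h  : (i : Fin M) → Fin (J i) → G.Carrier
      E  : (i : Fin M) → Fin (J i) → FinSubset H

  record Map : Set (a ⊔ b ⊔ c ⊔ d) where
    field
      fun  : G.Carrier → H.Carrier
      cong : ∀ {x y} → x G.≈ y → fun x H.≈ fun y

  InTranslate : (G.Carrier → H.Carrier) → G.Carrier → G.Carrier →
                FinSubset H → H.Carrier → Set (c ⊔ d)
  InTranslate α x hh Eij y =
    Σ H.Carrier λ e → (_∈ₛ_ H e Eij) × (y H.≈ (α (x G.∙ hh) H.∙ e))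

  Obeys : System → (G.Carrier → H.Carrier) → Set (a ⊔ c ⊔ d)
  Obeys S α = ∀ (i : Fin M) (x : G.Carrier) →
      (∀ (j j′ : Fin (J i)) → ¬ (j ≡ j′) → ∀ y →
         ¬ (InTranslate α x (h i j) (E i j) y × InTranslate α x (h i j′) (E i j′) y))
    × (∀ y → (_∈ₛ_ H y (E′ i)) ⇔ (Σ (Fin (J i)) λ j → InTranslate α x (h i j) (E i j) y))
    where open System S

  Satisfiable : System → Set (a ⊔ b ⊔ c ⊔ d)
  Satisfiable S = Σ Map λ α → Obeys S (Map.fun α)

module _ (G : AbelianGroup a b) (H′ : AbelianGroup c d) where
  private
    module G = AbelianGroup G
    module H′ = AbelianGroup H′

  _≈²_ : G.Carrier × H′.Carrier → G.Carrier × H′.Carrier → Set (b ⊔ d)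
  (x , y) ≈² (x′ , y′) = (x G.≈ x′) × (y H′.≈ y′)

  _+²_ : G.Carrier × H′.Carrier → G.Carrier × H′.Carrier → G.Carrier × H′.Carrier
  (x , y) +² (x′ , y′) = (x G.∙ x′) , (y H′.∙ y′)

  _∈F_ : G.Carrier × H′.Carrier → List (G.Carrier × H′.Carrier) → Set (a ⊔ b ⊔ c ⊔ d)
  z ∈F F = Any (z ≈²_) F

  Tiles : List (G.Carrier × H′.Carrier) → FinSubset H′ → Set (lsuc (a ⊔ b ⊔ c ⊔ d))
  Tiles F E′ = Σ (G.Carrier × H′.Carrier → Set (a ⊔ b ⊔ c ⊔ d)) λ A →
      (∀ z → (_∈ₛ_ H′ (proj₂ z) E′) ⇔
             (Σ (G.Carrier × H′.Carrier) λ a → Σ (G.Carrier × H′.Carrier) λ f →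
                A a × (f ∈F F) × (z ≈² (a +² f))))
    × (∀ a a′ f f′ → A a → A a′ → f ∈F F → f′ ∈F F →
         (a +² f) ≈² (a′ +² f′) → (a ≈² a′) × (f ≈² f′))

module _ (G : AbelianGroup a b) {k k* : ℕ}
         (H : Fin k → AbelianGroup c d) (H* : Fin k* → AbelianGroup c d) where
  private
    module G = AbelianGroup G

  joinFam : Fin k ⊎ Fin k* → AbelianGroup c d
  joinFam = [ H , H* ]

  joinMap : (G.Carrier → AbelianGroup.Carrier (ΠGroup H)) →
            (G.Carrier → AbelianGroup.Carrier (ΠGroup H*)) →
            G.Carrier → AbelianGroup.Carrier (ΠGroup joinFam)
  joinMap α α* x (inj₁ u) = α x u
  joinMap α α* x (inj₂ u) = α* x u

  WeaklySatisfiable : System G (ΠGroup joinFam) → Set (a ⊔ b ⊔ c ⊔ d)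
  WeaklySatisfiable S* =
    Σ (Map G (ΠGroup H)) λ α → Σ (Map G (ΠGroup H*)) λ α* →
      Obeys G (ΠGroup joinFam) S* (joinMap (Map.fun α) (Map.fun α*))

TilingReduction : (G : AbelianGroup a b) (c d : Level) {ℓ : Level} →
                  Set ℓ → Set (lsuc (a ⊔ b ⊔ c ⊔ d) ⊔ ℓ)
TilingReduction G c d Sat =
  Σ (AbelianGroup c d) λ H′ → IsFinite H′ ×
  Σ (FinSubset H′) λ E′ →
  Σ (List (AbelianGroup.Carrier G × AbelianGroup.Carrier H′)) λ F →
    Tiles G H′ F E′ ⇔ Sat

{-# OPTIONS --safe #-}
-- Put H′ = H × ℤ₂ⁿ × (ℤ₂ × ℤ₂ᴹ × ℤ₂ⁿ), with n ≥ 1 and n ≥ every J i. The last factor marks the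
-- layers of E′: a main layer H × ℤ₂ⁿ × {(b, 0, 0)}, a layer E′ᵢ × ℤ₂ⁿ × {(0, δᵢ, 0)} for every
-- equation i, and a layer H × ℤ₂ⁿ × {(0, 0, δₖ)} for every key k. The tile F consists of the fill
-- pieces (0, w, 0, (b, 0, 0)), the equation pieces (-hᵢⱼ, e, δ_{t(i,j)}, (0, δᵢ, 0)) for e ∈ Eᵢⱼ, the
-- offsets (0, x, 0, (0, 0, δₖ)) for x ≠ 0, and the flips (0, 0, δₖ, (0, 0, δₖ)).
-- In a tiling every translate has trivial marker (else adding a fill or a flip leaves E′), so the
-- fill pieces tile the main layer with exactly one translate over each (x, σ) ∈ G × ℤ₂ⁿ; let V(x, σ)
-- be its H-coordinate. Over (x, σ) the k-th key layer gets the offsets of that translate, i.e.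
-- everything but V(x, σ), and one flip from the translate over (x, σ + δₖ); hence V(x, σ + δₖ) =
-- V(x, σ). With α = V(·, 0), the i-th equation layer over x is then tiled exactly when the sets
-- α(x + hᵢⱼ) + Eᵢⱼ partition E′ᵢ, the distinct tags δ_{t(i,j)} keeping apart translates with equal
-- hᵢⱼ. Conversely a solution α gives the tiling by the translates (x, α x, σ, 0).
-- Families (H_u) are the single group ∏ H_u, and the existential quantification of P* is
-- satisfiable exactly when P* is, so (ii) and (iii) follow from (i).

module Submission where

open import Defs
open import Level using (Level; Lift; lift; 0ℓ) renaming (_⊔_ to _⊔ˡ_)
open import Algebra.Bundles using (Group; AbelianGroup; CommutativeRing)
import Algebra.Construct.DirectProduct as DirectProduct
import Algebra.Properties.Group as GroupProperties
open import Data.Bool using (Bool; true; false; not)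
import Data.Bool.Properties as Boolₚ
open import Data.Empty using (⊥-elim)
open import Data.Fin using (Fin; zero; suc; inject≤)
import Data.Fin.Properties as Finₚ
open import Data.List
  using (List; []; _∷_; _++_; map; concatMap; allFin; tabulate; cartesianProduct; cartesianProductWith)
open import Data.List.Extrema.Nat using (max; v≤max⁺)
import Data.List.Membership.Setoid as SetoidMembership
import Data.List.Membership.Setoid.Properties as Membershipₚ
open import Data.List.Membership.Propositional.Properties using (∈-allFin)
open import Data.List.Relation.Unary.Any using (Any; here; there)
import Data.List.Relation.Unary.Any as Any
import Data.List.Relation.Unary.Any.Properties as Anyₚ
open import Data.Nat using (ℕ; zero; suc; _≤_)
import Data.Nat.Properties as ℕₚ
open import Data.Product using (Σ; _×_; _,_; proj₁; proj₂)
open import Data.Sum using (_⊎_; inj₁; inj₂; [_,_])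
open import Data.Unit.Polymorphic using (⊤; tt)
open import Function using (_∘_)
open import Function.Bundles using (_⇔_; mk⇔; Equivalence)
open import Function.Construct.Composition using (_⇔-∘_)
open import Relation.Binary using (Setoid)
import Relation.Binary.Reasoning.Setoid as Reasoning
open import Relation.Binary.PropositionalEquality as ≡ using (_≡_; refl; cong)
open import Relation.Nullary using (Dec; yes; no; ¬_)
open import Relation.Nullary.Decidable using (_×-dec_; ¬?; map′; does; dec-true)
open import Relation.Unary using (Pred; Decidable)

private
  variable
    c d c′ d′ : Level

module _ (K : Group c d) where
  open Group K
  open GroupProperties K using (\\-leftDividesˡ)

  ⁻¹∙≈ε⇒≈ : ∀ {x y} → x ⁻¹ ∙ y ≈ ε → x ≈ y
  ⁻¹∙≈ε⇒≈ {x} {y} x⁻¹y≈ε = trans (sym (identityʳ x)) (trans (∙-congˡ (sym x⁻¹y≈ε)) (\\-leftDividesˡ x y))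

-- Finite abelian groups

_×ᴳ_ : AbelianGroup c d → AbelianGroup c′ d′ → AbelianGroup (c ⊔ˡ c′) (d ⊔ˡ d′)
_×ᴳ_ = DirectProduct.abelianGroup

infixr 2 _×ᴳ_

isFinite-×ᴳ : (K : AbelianGroup c d) (L : AbelianGroup c′ d′) →
              IsFinite K → IsFinite L → IsFinite (K ×ᴳ L)
isFinite-×ᴳ K L (K? , ks , ks-complete) (L? , ls , ls-complete) =
  (λ (x , y) (x′ , y′) → K? x x′ ×-dec L? y y′) ,
  cartesianProduct ks ls ,
  λ (x , y) → Membershipₚ.∈-cartesianProduct⁺ (AbelianGroup.setoid K) (AbelianGroup.setoid L)
                (ks-complete x) (ls-complete y)

isFinite-Π-Fin : ∀ k (H : Fin k → AbelianGroup c d) → (∀ u → IsFinite (H u)) → IsFinite (ΠGroup H)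
isFinite-Π-Fin zero H finite = (λ _ _ → yes λ ()) , (λ ()) ∷ [] , λ _ → here λ ()
isFinite-Π-Fin (suc k) H finite with finite zero | isFinite-Π-Fin k (H ∘ suc) (finite ∘ suc)
... | H₀? , hs , hs-complete | Rest? , rest , rest-complete =
  decide , cartesianProductWith cons hs rest , complete
  where
  module Π = AbelianGroup (ΠGroup H)
  module H₀ = AbelianGroup (H zero)
  module Rest = AbelianGroup (ΠGroup (H ∘ suc))

  cons : H₀.Carrier → Rest.Carrier → Π.Carrier
  cons x f zero    = x
  cons x f (suc u) = f u

  decide : ∀ f g → Dec (f Π.≈ g)
  decide f g = map′ (λ { (e₀ , e) zero → e₀ ; (e₀ , e) (suc u) → e u }) (λ e → e zero , λ u → e (suc u))
                    (H₀? (f zero) (g zero) ×-dec Rest? (λ u → f (suc u)) (λ u → g (suc u)))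

  complete : ∀ f → _∈ₛ_ (ΠGroup H) f (cartesianProductWith cons hs rest)
  complete f = Membershipₚ.∈-resp-≈ Π.setoid (λ { zero → H₀.refl ; (suc u) → AbelianGroup.refl (H (suc u)) })
    (Membershipₚ.∈-cartesianProductWith⁺ H₀.setoid Rest.setoid Π.setoid
      (λ { e₀ e zero → e₀ ; e₀ e (suc u) → e u })
      (hs-complete (f zero)) (rest-complete (λ u → f (suc u))))

isFinite-Π-⊎ : {I J : Set} (H : I ⊎ J → AbelianGroup c d) →
               IsFinite (ΠGroup (H ∘ inj₁)) → IsFinite (ΠGroup (H ∘ inj₂)) → IsFinite (ΠGroup H)
isFinite-Π-⊎ H (H₁? , hs₁ , hs₁-complete) (H₂? , hs₂ , hs₂-complete) =
  decide , cartesianProductWith [_,_] hs₁ hs₂ , complete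
  where
  module Π = AbelianGroup (ΠGroup H)

  decide : ∀ f g → Dec (f Π.≈ g)
  decide f g = map′ (λ { (e₁ , e₂) (inj₁ u) → e₁ u ; (e₁ , e₂) (inj₂ u) → e₂ u })
                    (λ e → (λ u → e (inj₁ u)) , (λ u → e (inj₂ u)))
                    (H₁? (f ∘ inj₁) (g ∘ inj₁) ×-dec H₂? (f ∘ inj₂) (g ∘ inj₂))

  complete : ∀ f → _∈ₛ_ (ΠGroup H) f (cartesianProductWith [_,_] hs₁ hs₂)
  complete f = Membershipₚ.∈-resp-≈ Π.setoid
    (λ { (inj₁ u) → AbelianGroup.refl (H (inj₁ u)) ; (inj₂ u) → AbelianGroup.refl (H (inj₂ u)) })
    (Membershipₚ.∈-cartesianProductWith⁺ (AbelianGroup.setoid (ΠGroup (H ∘ inj₁)))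
      (AbelianGroup.setoid (ΠGroup (H ∘ inj₂))) Π.setoid
      (λ { e₁ e₂ (inj₁ u) → e₁ u ; e₁ e₂ (inj₂ u) → e₂ u })
      (hs₁-complete (f ∘ inj₁)) (hs₂-complete (f ∘ inj₂)))

ℤ₂ : AbelianGroup 0ℓ 0ℓ
ℤ₂ = CommutativeRing.+-abelianGroup Boolₚ.xor-∧-commutativeRing

isFinite-ℤ₂ : IsFinite ℤ₂
isFinite-ℤ₂ = Boolₚ._≟_ , true ∷ false ∷ [] , λ { true → here refl ; false → there (here refl) }

Bits : ℕ → AbelianGroup 0ℓ 0ℓ
Bits m = ΠGroup {I = Fin m} (λ _ → ℤ₂)

isFinite-Bits : ∀ m → IsFinite (Bits m)
isFinite-Bits m = isFinite-Π-Fin m (λ _ → ℤ₂) (λ _ → isFinite-ℤ₂)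

module _ {m : ℕ} where
  open AbelianGroup (Bits m) using (Carrier; _≈_; ε)

  δ : Fin m → Carrier
  δ k k′ = does (k Finₚ.≟ k′)

  δ-diag : ∀ k → δ k k ≡ true
  δ-diag k = dec-true (k Finₚ.≟ k) refl

  δ-injective : ∀ {k k′} → δ k ≈ δ k′ → k ≡ k′
  δ-injective {k} {k′} e = ≡.sym (witness (k′ Finₚ.≟ k) (≡.trans (≡.sym (e k)) (δ-diag k)))
    where
    witness : ∀ {p} {P : Set p} (P? : Dec P) → does P? ≡ true → P
    witness (yes p) _ = p

  δ≉ε : ∀ k → ¬ (δ k ≈ ε)
  δ≉ε k e with ≡.trans (≡.sym (δ-diag k)) (e k)
  ... | ()

module _ {c d p} (S : Setoid c d) {P : Pred (Setoid.Carrier S) p} (P? : Decidable P) where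
  open Setoid S using (Carrier; _≈_)
  open SetoidMembership S using (_∈_)

  witnesses : List Carrier → List (Σ Carrier P)
  witnesses [] = []
  witnesses (x ∷ xs) with P? x
  ... | yes px = (x , px) ∷ witnesses xs
  ... | no _   = witnesses xs

  witnesses-complete : (∀ {x y} → x ≈ y → P x → P y) → ∀ {x xs} → x ∈ xs → P x →
                       Any (λ w → x ≈ proj₁ w) (witnesses xs)
  witnesses-complete resp {xs = y ∷ xs} x∈ px with P? y | x∈
  ... | yes _  | here x≈y  = here x≈y
  ... | yes _  | there x∈′ = there (witnesses-complete resp x∈′ px)
  ... | no ¬py | here x≈y  = ⊥-elim (¬py (resp x≈y px))
  ... | no _   | there x∈′ = witnesses-complete resp x∈′ px

-- Systems of functional equations

module _ {a b c d} (G : AbelianGroup a b) (K : AbelianGroup c d) (S : System G K) where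
  open System S
  private
    module G = AbelianGroup G
    module K = AbelianGroup K

  obeys-resp : ∀ {f g} → (∀ x → f x K.≈ g x) → Obeys G K S f → Obeys G K S g
  obeys-resp {f} {g} f≈g f-obeys i x = disjoint , covers
    where
    translate-resp : ∀ {f g} → (∀ x → f x K.≈ g x) → ∀ {y t E w} →
                     InTranslate G K f y t E w → InTranslate G K g y t E w
    translate-resp f≈g {y} {t} (e , e∈ , w≈) = e , e∈ , K.trans w≈ (K.∙-congʳ (f≈g (y G.∙ t)))

    g≈f : ∀ x → g x K.≈ f x
    g≈f x = K.sym (f≈g x)

    disjoint : ∀ j j′ → ¬ j ≡ j′ → ∀ w →
               ¬ (InTranslate G K g x (h i j) (E i j) w × InTranslate G K g x (h i j′) (E i j′) w)
    disjoint j j′ j≢j′ w (in-j , in-j′) =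
      proj₁ (f-obeys i x) j j′ j≢j′ w (translate-resp g≈f in-j , translate-resp g≈f in-j′)

    covers : ∀ w → _∈ₛ_ K w (E′ i) ⇔ (Σ (Fin (J i)) λ j → InTranslate G K g x (h i j) (E i j) w)
    covers w = mk⇔
      (λ w∈ → let j , in-j = Equivalence.to (proj₂ (f-obeys i x) w) w∈ in j , translate-resp f≈g in-j)
      (λ (j , in-j) → Equivalence.from (proj₂ (f-obeys i x) w) (j , translate-resp g≈f in-j))

module _ {a b c d} (G : AbelianGroup a b) {k k* : ℕ}
         (H : Fin k → AbelianGroup c d) (H* : Fin k* → AbelianGroup c d)
         (S* : System G (ΠGroup (joinFam G H H*))) where

  satisfiable⇔weaklySatisfiable : Satisfiable G (ΠGroup (joinFam G H H*)) S* ⇔ WeaklySatisfiable G H H* S*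
  satisfiable⇔weaklySatisfiable = mk⇔ split join
    where
    split : Satisfiable G (ΠGroup (joinFam G H H*)) S* → WeaklySatisfiable G H H* S*
    split (β , β-obeys) = α , α* , obeys-resp G _ S* unsplit β-obeys
      where
      α : Map G (ΠGroup H)
      α = record { fun = λ x u → Map.fun β x (inj₁ u) ; cong = λ x≈y u → Map.cong β x≈y (inj₁ u) }
      α* : Map G (ΠGroup H*)
      α* = record { fun = λ x u → Map.fun β x (inj₂ u) ; cong = λ x≈y u → Map.cong β x≈y (inj₂ u) }
      unsplit : ∀ x → AbelianGroup._≈_ (ΠGroup (joinFam G H H*))
                        (Map.fun β x) (joinMap G H H* (Map.fun α) (Map.fun α*) x)
      unsplit x (inj₁ u) = AbelianGroup.refl (H u)
      unsplit x (inj₂ u) = AbelianGroup.refl (H* u)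

    join : WeaklySatisfiable G H H* S* → Satisfiable G (ΠGroup (joinFam G H H*)) S*
    join (α , α* , obeys) =
      record { fun = joinMap G H H* (Map.fun α) (Map.fun α*)
             ; cong = λ { x≈y (inj₁ u) → Map.cong α x≈y u ; x≈y (inj₂ u) → Map.cong α* x≈y u } } ,
      obeys

TilingReduction-resp : ∀ {a b c d ℓ ℓ′} (G : AbelianGroup a b) {P : Set ℓ} {Q : Set ℓ′} →
                       TilingReduction G c d P → P ⇔ Q → TilingReduction G c d Q
TilingReduction-resp G (H′ , finite , E′ , F , tiles⇔P) P⇔Q = H′ , finite , E′ , F , P⇔Q ⇔-∘ tiles⇔P

-- Layer markers

module Shapes (M n : ℕ) where

  data Shape : Set where
    main : Bool → Shape
    eqn  : Fin M → Shape
    key  : Fin n → Shape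

  shapes : List Shape
  shapes = main true ∷ main false ∷ map eqn (allFin M) ++ map key (allFin n)

  shapes-complete : ∀ s → Any (s ≡_) shapes
  shapes-complete (main true)  = here refl
  shapes-complete (main false) = there (here refl)
  shapes-complete (eqn i) = there (there (Anyₚ.++⁺ˡ (Anyₚ.map⁺ (Any.map (cong eqn) (∈-allFin i)))))
  shapes-complete (key k) =
    there (there (Anyₚ.++⁺ʳ (map eqn (allFin M)) (Anyₚ.map⁺ (Any.map (cong key) (∈-allFin k)))))

  Marker : AbelianGroup 0ℓ 0ℓ
  Marker = ℤ₂ ×ᴳ Bits M ×ᴳ Bits n

  isFinite-Marker : IsFinite Marker
  isFinite-Marker = isFinite-×ᴳ ℤ₂ (Bits M ×ᴳ Bits n) isFinite-ℤ₂
                      (isFinite-×ᴳ (Bits M) (Bits n) (isFinite-Bits M) (isFinite-Bits n))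

  private
    module Mk = AbelianGroup Marker
    module Bitsₘ = AbelianGroup (Bits M)
    module Bitsₙ = AbelianGroup (Bits n)

  open Mk using (Carrier; _≈_; _∙_; ε)

  marker : Shape → Carrier
  marker (main b) = b , Bitsₘ.ε , Bitsₙ.ε
  marker (eqn i)  = false , δ i , Bitsₙ.ε
  marker (key k)  = false , Bitsₘ.ε , δ k

  marker-injective : ∀ {s s′} → marker s ≈ marker s′ → s ≡ s′
  marker-injective {main b} {main b′} (e , _)     = cong main e
  marker-injective {main _} {eqn i′}  (_ , e , _) = ⊥-elim (δ≉ε i′ (Bitsₘ.sym e))
  marker-injective {main _} {key k′}  (_ , _ , e) = ⊥-elim (δ≉ε k′ (Bitsₙ.sym e))
  marker-injective {eqn i}  {main _}  (_ , e , _) = ⊥-elim (δ≉ε i e)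
  marker-injective {eqn i}  {eqn i′}  (_ , e , _) = cong eqn (δ-injective e)
  marker-injective {eqn i}  {key _}   (_ , e , _) = ⊥-elim (δ≉ε i e)
  marker-injective {key k}  {main _}  (_ , _ , e) = ⊥-elim (δ≉ε k e)
  marker-injective {key k}  {eqn _}   (_ , _ , e) = ⊥-elim (δ≉ε k e)
  marker-injective {key k}  {key k′}  (_ , _ , e) = cong key (δ-injective e)

  marker-cancel : ∀ {m m′ s s′} → m ≈ ε → m′ ≈ ε → m ∙ marker s ≈ m′ ∙ marker s′ → s ≡ s′
  marker-cancel {m} {m′} {s} {s′} m≈ε m′≈ε e = marker-injective (begin
    marker s        ≈⟨ untag m≈ε ⟨
    m ∙ marker s    ≈⟨ e ⟩
    m′ ∙ marker s′  ≈⟨ untag m′≈ε ⟩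
    marker s′       ∎)
    where
    open Reasoning Mk.setoid
    untag : ∀ {m x} → m ≈ ε → m ∙ x ≈ x
    untag {x = x} m≈ε = Mk.trans (Mk.∙-congʳ m≈ε) (Mk.identityˡ x)

  marker-cancelˡ : ∀ {m s s′} → m ≈ ε → m ∙ marker s ≈ marker s′ → s ≡ s′
  marker-cancelˡ m≈ε e = marker-cancel m≈ε Mk.refl (Mk.trans e (Mk.sym (Mk.identityˡ _)))

  marker-trivial : ∀ {b l κ k} →
                   (Σ Shape λ s → (b , l , κ) ∙ marker (main (not b)) ≈ marker s) →
                   (Σ Shape λ s → (b , l , κ) ∙ marker (key k) ≈ marker s) → (b , l , κ) ≈ ε
  marker-trivial {b} {l} {κ} {k} (s , e) (s′ , e′) = b≡false s′ e′ , l≈ε , κ≈ε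
    where
    lκ≈ε : ∀ s → (b , l , κ) ∙ marker (main (not b)) ≈ marker s → (l Bitsₘ.≈ Bitsₘ.ε) × (κ Bitsₙ.≈ Bitsₙ.ε)
    lκ≈ε (main _) (_ , el , eκ) = Bitsₘ.trans (Bitsₘ.sym (Bitsₘ.identityʳ l)) el ,
                                  Bitsₙ.trans (Bitsₙ.sym (Bitsₙ.identityʳ κ)) eκ
    lκ≈ε (eqn _)  (eb , _) with ≡.trans (≡.sym (Boolₚ.xor-inverseʳ b)) eb
    ... | ()
    lκ≈ε (key _)  (eb , _) with ≡.trans (≡.sym (Boolₚ.xor-inverseʳ b)) eb
    ... | ()
    l≈ε : l Bitsₘ.≈ Bitsₘ.ε
    l≈ε = proj₁ (lκ≈ε s e)
    κ≈ε : κ Bitsₙ.≈ Bitsₙ.ε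
    κ≈ε = proj₂ (lκ≈ε s e)
    κ∙δ≉ε : ¬ κ Bitsₙ.∙ δ k Bitsₙ.≈ Bitsₙ.ε
    κ∙δ≉ε eκ = δ≉ε k (Bitsₙ.trans (Bitsₙ.sym (Bitsₙ.trans (Bitsₙ.∙-congʳ κ≈ε) (Bitsₙ.identityˡ (δ k)))) eκ)
    b≡false : ∀ s′ → (b , l , κ) ∙ marker (key k) ≈ marker s′ → b ≡ false
    b≡false (main _) (_ , _ , eκ) = ⊥-elim (κ∙δ≉ε eκ)
    b≡false (eqn _)  (_ , _ , eκ) = ⊥-elim (κ∙δ≉ε eκ)
    b≡false (key _)  (eb , _)     = ≡.trans (≡.sym (Boolₚ.xor-identityʳ b)) eb

-- The tiling reduction

module Construction {a b c d : Level} (G : AbelianGroup a b) (H : AbelianGroup c d)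
                    (finite : IsFinite H) (S : System G H) where
  open System S

  module G = AbelianGroup G
  module H = AbelianGroup H
  module Gₚ = GroupProperties G.group
  module Hₚ = GroupProperties H.group

  H? : ∀ x y → Dec (x H.≈ y)
  H? = proj₁ finite

  hs : List H.Carrier
  hs = proj₁ (proj₂ finite)

  hs-complete : ∀ w → _∈ₛ_ H w hs
  hs-complete = proj₂ (proj₂ finite)

  -- n ≥ 1 because A-normal below uses the key layer of index zero, and tag i embeds Fin (J i)
  -- into Fin n; only the bound J i ≤ maxJ matters, so maxJ is kept abstract.
  abstract
    maxJ : ℕ
    maxJ = max 0 (tabulate J)

    J≤maxJ : ∀ i → J i ≤ maxJ
    J≤maxJ i = v≤max⁺ 0 (tabulate J) (inj₂ (Anyₚ.tabulate⁺ i ℕₚ.≤-refl))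

  n : ℕ
  n = suc maxJ

  tag : (i : Fin M) → Fin (J i) → Fin n
  tag i j = inject≤ j (ℕₚ.m≤n⇒m≤1+n (J≤maxJ i))

  tag-injective : ∀ {i j j′} → tag i j ≡ tag i j′ → j ≡ j′
  tag-injective = Finₚ.inject≤-injective _ _ _ _

  open Shapes M n public
  module Bitsₙ = AbelianGroup (Bits n)
  module Bitsₙₚ = GroupProperties Bitsₙ.group
  module Marker = AbelianGroup Marker

  H′ : AbelianGroup c d
  H′ = H ×ᴳ Bits n ×ᴳ Marker

  module H′ = AbelianGroup H′
  module G×H′ = AbelianGroup (G ×ᴳ H′)
  module G×H′ₚ = GroupProperties G×H′.group

  isFinite-H′ : IsFinite H′
  isFinite-H′ = isFinite-×ᴳ H (Bits n ×ᴳ Marker) finite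
                  (isFinite-×ᴳ (Bits n) Marker (isFinite-Bits n) isFinite-Marker)

  data Piece : Set (c ⊔ˡ d) where
    fill     : H.Carrier → Bool → Piece
    equation : (i : Fin M) (j : Fin (J i)) (e : H.Carrier) → _∈ₛ_ H e (E i j) → Piece
    offset   : Fin n → (x : H.Carrier) → ¬ x H.≈ H.ε → Piece
    flip     : Fin n → Piece

  shape : Piece → Shape
  shape (fill _ b)         = main b
  shape (equation i _ _ _) = eqn i
  shape (offset k _ _)     = key k
  shape (flip k)           = key k

  position : Piece → G.Carrier
  position (equation i j _ _) = h i j G.⁻¹
  position _                  = G.ε

  value : Piece → H.Carrier
  value (fill w _)         = w
  value (equation _ _ e _) = e
  value (offset _ x _)     = x
  value (flip _)           = H.ε

  tags : Piece → Bitsₙ.Carrier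
  tags (equation i j _ _) = δ (tag i j)
  tags (flip k)           = δ k
  tags _                  = Bitsₙ.ε

  ⟦_⟧ᵖ : Piece → G.Carrier × H′.Carrier
  ⟦ p ⟧ᵖ = position p , value p , tags p , marker (shape p)

  piecesOf : Shape → List Piece
  piecesOf (main b) = map (λ w → fill w b) hs
  piecesOf (eqn i)  = concatMap (λ j → map (λ (e , e∈) → equation i j e e∈)
                                          (witnesses H.setoid (λ e → Any.any? (H? e) (E i j)) hs))
                                (allFin (J i))
  piecesOf (key k)  = flip k ∷ map (λ (x , x≉ε) → offset k x x≉ε)
                                   (witnesses H.setoid (λ x → ¬? (H? x H.ε)) hs)

  tile : List (G.Carrier × H′.Carrier)
  tile = map ⟦_⟧ᵖ (concatMap piecesOf shapes)

  ∈tile⁺ : ∀ {f} p → f G×H′.≈ ⟦ p ⟧ᵖ → _∈F_ G H′ f tile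
  ∈tile⁺ p f≈p = Anyₚ.map⁺ (Any.map (G×H′.trans f≈p)
                  (Anyₚ.concatMap⁺ piecesOf (Any.map (λ { refl → in-piecesOf p }) (shapes-complete (shape p)))))
    where
    in-piecesOf : ∀ p → Any (λ p′ → ⟦ p ⟧ᵖ G×H′.≈ ⟦ p′ ⟧ᵖ) (piecesOf (shape p))
    in-piecesOf (fill w b) = Anyₚ.map⁺ (Any.map (λ w≈ → G.refl , w≈ , Bitsₙ.refl , Marker.refl)
                                          (hs-complete w))
    in-piecesOf (equation i j e e∈) = Anyₚ.concatMap⁺ _ (Any.map (λ { refl → Anyₚ.map⁺ (Any.map
        (λ e≈ → G.refl , e≈ , Bitsₙ.refl , Marker.refl)
        (witnesses-complete H.setoid _ (Membershipₚ.∈-resp-≈ H.setoid) (hs-complete e) e∈)) })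
      (∈-allFin j))
    in-piecesOf (offset k x x≉ε) = there (Anyₚ.map⁺ (Any.map (λ x≈ → G.refl , x≈ , Bitsₙ.refl , Marker.refl)
        (witnesses-complete H.setoid _ (λ x≈y x≉ε y≈ε → x≉ε (H.trans x≈y y≈ε))
          (hs-complete x) x≉ε)))
    in-piecesOf (flip k) = here G×H′.refl

  ∈tile⁻ : ∀ {f} → _∈F_ G H′ f tile → Σ Piece λ p → f G×H′.≈ ⟦ p ⟧ᵖ
  ∈tile⁻ f∈ = Any.satisfied (Anyₚ.map⁻ f∈)

  Admissible : Shape → Pred H.Carrier (c ⊔ˡ d)
  Admissible (eqn i) w = _∈ₛ_ H w (E′ i)
  Admissible _       _ = ⊤

  admissible? : ∀ s → Decidable (Admissible s)
  admissible? (main _) _ = yes tt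
  admissible? (eqn i)  w = Any.any? (H? w) (E′ i)
  admissible? (key _)  _ = yes tt

  admissible-resp : ∀ s {w w′} → w H.≈ w′ → Admissible s w → Admissible s w′
  admissible-resp (main _) _ _ = tt
  admissible-resp (eqn _)  w≈w′ w∈ = Membershipₚ.∈-resp-≈ H.setoid w≈w′ w∈
  admissible-resp (key _)  _ _ = tt

  data Layer : Set (c ⊔ˡ d) where
    layer : (s : Shape) (w : H.Carrier) → Admissible s w → Bitsₙ.Carrier → Layer

  ⟦_⟧ˡ : Layer → H′.Carrier
  ⟦ layer s w _ σ ⟧ˡ = w , σ , marker s

  layersOf : Shape → List Layer
  layersOf s = cartesianProductWith (λ (w , w-adm) σ → layer s w w-adm σ)
                 (witnesses H.setoid (admissible? s) hs) (proj₁ (proj₂ (isFinite-Bits n)))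

  region : FinSubset H′
  region = map ⟦_⟧ˡ (concatMap layersOf shapes)

  ∈region⁺ : ∀ {q} L → q H′.≈ ⟦ L ⟧ˡ → _∈ₛ_ H′ q region
  ∈region⁺ (layer s w w-adm σ) q≈L = Anyₚ.map⁺ (Any.map (H′.trans q≈L)
    (Anyₚ.concatMap⁺ layersOf (Any.map (λ { refl → Anyₚ.cartesianProductWith⁺ _
        (λ w≈ σ≈ → w≈ , σ≈ , Marker.refl)
        (witnesses-complete H.setoid (admissible? s) (admissible-resp s) (hs-complete w) w-adm)
        (proj₂ (proj₂ (isFinite-Bits n)) σ) })
      (shapes-complete s))))

  ∈region⁻ : ∀ {q} → _∈ₛ_ H′ q region → Σ Layer λ L → q H′.≈ ⟦ L ⟧ˡ
  ∈region⁻ q∈ = Any.satisfied (Anyₚ.map⁻ q∈)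

  Point : Set (a ⊔ˡ c)
  Point = G×H′.Carrier

  tags-of : Point → Bitsₙ.Carrier
  tags-of (_ , _ , σ , _) = σ

  tags-of-cong : ∀ {z z′} → z G×H′.≈ z′ → tags-of z Bitsₙ.≈ tags-of z′
  tags-of-cong (_ , _ , σ≈ , _) = σ≈

  value-of : Point → H.Carrier
  value-of (_ , w , _ , _) = w

  marker-of : Point → Marker.Carrier
  marker-of (_ , _ , _ , m) = m

  CoveredBy : ∀ {ℓ} → (Point → Set ℓ) → Point → Set (a ⊔ˡ b ⊔ˡ c ⊔ˡ d ⊔ˡ ℓ)
  CoveredBy P z = Σ Point λ a → Σ Piece λ p → P a × (z G×H′.≈ a G×H′.∙ ⟦ p ⟧ᵖ)

  marker-of-layer : ∀ {q} → (Σ Layer λ L → q H′.≈ ⟦ L ⟧ˡ) → Σ Shape λ s → proj₂ (proj₂ q) Marker.≈ marker s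
  marker-of-layer (layer s _ _ _ , q≈L) = s , proj₂ (proj₂ q≈L)

  admissible-in-region : ∀ {s w σ} → _∈ₛ_ H′ (w , σ , marker s) region → Admissible s w
  admissible-in-region {s} q∈ with ∈region⁻ q∈
  ... | layer s′ w′ w′-adm _ , (w≈w′ , _ , s≈s′) with marker-injective {s} {s′} s≈s′
  ... | refl = admissible-resp s (H.sym w≈w′) w′-adm

  main-piece : ∀ p {b} → shape p ≡ main b → (position p G.≈ G.ε) × (tags p Bitsₙ.≈ Bitsₙ.ε)
  main-piece (fill _ _)         refl = G.refl , Bitsₙ.refl
  main-piece (equation _ _ _ _) ()
  main-piece (offset _ _ _)     ()
  main-piece (flip _)           ()

  module FromTiling (tiling : Tiles G H′ tile region) where
    A : Point → Set (a ⊔ˡ b ⊔ˡ c ⊔ˡ d)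
    A = proj₁ tiling

    sum-in-region : ∀ {a} → A a → ∀ p → Σ Layer λ L → proj₂ (a G×H′.∙ ⟦ p ⟧ᵖ) H′.≈ ⟦ L ⟧ˡ
    sum-in-region {a} a∈A p = ∈region⁻ (Equivalence.from (proj₁ (proj₂ tiling) (a G×H′.∙ ⟦ p ⟧ᵖ))
                                (a , ⟦ p ⟧ᵖ , a∈A , ∈tile⁺ p G×H′.refl , G×H′.refl))

    decompose : ∀ y L → CoveredBy A (y , ⟦ L ⟧ˡ)
    decompose y L with Equivalence.to (proj₁ (proj₂ tiling) (y , ⟦ L ⟧ˡ)) (∈region⁺ L H′.refl)
    ... | a , f , a∈A , f∈ , e with ∈tile⁻ f∈
    ... | p , f≈p = a , p , a∈A , G×H′.trans e (G×H′.∙-congˡ {a} f≈p)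

    unique-sum : ∀ {a a′} p p′ → A a → A a′ → a G×H′.∙ ⟦ p ⟧ᵖ G×H′.≈ a′ G×H′.∙ ⟦ p′ ⟧ᵖ →
                 (a G×H′.≈ a′) × (⟦ p ⟧ᵖ G×H′.≈ ⟦ p′ ⟧ᵖ)
    unique-sum p p′ a∈A a′∈A =
      proj₂ (proj₂ tiling) _ _ _ _ a∈A a′∈A (∈tile⁺ p G×H′.refl) (∈tile⁺ p′ G×H′.refl)

    A-normal : ∀ {a} → A a → marker-of a Marker.≈ Marker.ε
    A-normal {_ , _ , _ , b , l , κ} a∈A =
      marker-trivial {k = zero} (marker-of-layer (sum-in-region a∈A (fill H.ε (not b))))
                     (marker-of-layer (sum-in-region a∈A (flip zero)))

    markers-agree : ∀ {a a′} → A a → A a′ → ∀ m → marker-of a Marker.∙ m Marker.≈ marker-of a′ Marker.∙ m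
    markers-agree a∈A a′∈A m = Marker.∙-congʳ (Marker.trans (A-normal a∈A) (Marker.sym (A-normal a′∈A)))

    covering-shape : ∀ {y w σ s a p} → A a →
                     (y , w , σ , marker s) G×H′.≈ a G×H′.∙ ⟦ p ⟧ᵖ → shape p ≡ s
    covering-shape a∈A (_ , _ , _ , s≈) = marker-cancelˡ (A-normal a∈A) (Marker.sym s≈)

    point-over : ∀ y σ → Σ Point λ a → A a × (proj₁ a G.≈ y) × (tags-of a Bitsₙ.≈ σ)
    point-over y σ = from-decomposition (decompose y (layer (main false) H.ε tt σ))
      where
      from-decomposition : CoveredBy A (y , H.ε , σ , marker (main false)) →
                           Σ Point λ a → A a × (proj₁ a G.≈ y) × (tags-of a Bitsₙ.≈ σ)
      from-decomposition (a , p , a∈A , e@(y≈ , _ , σ≈ , _)) =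
        a , a∈A , G.sym (G.trans y≈ (G.trans (G.∙-congˡ (proj₁ p-main)) (G.identityʳ _))) ,
        Bitsₙ.sym (Bitsₙ.trans σ≈ (Bitsₙ.trans (Bitsₙ.∙-congˡ {tags-of a} (proj₂ p-main))
                                               (Bitsₙ.identityʳ _)))
        where
        p-main : (position p G.≈ G.ε) × (tags p Bitsₙ.≈ Bitsₙ.ε)
        p-main = main-piece p (covering-shape a∈A e)

    A-determined : ∀ {a a′} → A a → A a′ → proj₁ a G.≈ proj₁ a′ → tags-of a Bitsₙ.≈ tags-of a′ →
                   a G×H′.≈ a′
    A-determined {a} {a′} a∈A a′∈A x≈x′ σ≈σ′ =
      proj₁ (unique-sum (fill (value-of a H.⁻¹) false) (fill (value-of a′ H.⁻¹) false) a∈A a′∈A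
        (G.∙-congʳ x≈x′ , H.trans (H.inverseʳ _) (H.sym (H.inverseʳ _)) , Bitsₙ.∙-congʳ σ≈σ′ ,
         markers-agree a∈A a′∈A (marker (main false))))

    -- otherwise a ∙ flip k and a′ ∙ offset k (w′⁻¹ ∙ w) would be one point covered twice
    flip-invariant : ∀ {a a′} k → A a → A a′ → proj₁ a G.≈ proj₁ a′ →
                     tags-of a Bitsₙ.≈ Bitsₙ.ε → tags-of a′ Bitsₙ.≈ δ k → value-of a H.≈ value-of a′
    flip-invariant {a} {a′} k a∈A a′∈A x≈x′ σ≈ε σ′≈δ with H? (value-of a) (value-of a′)
    ... | yes w≈w′ = w≈w′
    ... | no w≉w′  = ⊥-elim (δ≉ε k (tags-of-cong (proj₂ (unique-sum (flip k) (offset k w′⁻¹w w′⁻¹w≉ε)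
                                                             a∈A a′∈A sums))))
      where
      w = value-of a
      w′ = value-of a′
      w′⁻¹w = w′ H.⁻¹ H.∙ w

      w′⁻¹w≉ε : ¬ w′⁻¹w H.≈ H.ε
      w′⁻¹w≉ε w′⁻¹w≈ε = w≉w′ (H.sym (⁻¹∙≈ε⇒≈ H.group w′⁻¹w≈ε))

      sums : a G×H′.∙ ⟦ flip k ⟧ᵖ G×H′.≈ a′ G×H′.∙ ⟦ offset k w′⁻¹w w′⁻¹w≉ε ⟧ᵖ
      sums = G.∙-congʳ x≈x′ ,
             H.trans (H.identityʳ w) (H.sym (Hₚ.\\-leftDividesˡ w′ w)) ,
             Bitsₙ.trans (Bitsₙ.trans (Bitsₙ.∙-congʳ σ≈ε) (Bitsₙ.identityˡ (δ k)))
                         (Bitsₙ.sym (Bitsₙ.trans (Bitsₙ.∙-congʳ σ′≈δ) (Bitsₙ.identityʳ (δ k)))) ,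
             markers-agree a∈A a′∈A (marker (key k))

    over : G.Carrier → Bitsₙ.Carrier → Point
    over y σ = proj₁ (point-over y σ)

    over∈A : ∀ y σ → A (over y σ)
    over∈A y σ = proj₁ (proj₂ (point-over y σ))

    over-base : ∀ y σ → proj₁ (over y σ) G.≈ y
    over-base y σ = proj₁ (proj₂ (proj₂ (point-over y σ)))

    over-tags : ∀ y σ → tags-of (over y σ) Bitsₙ.≈ σ
    over-tags y σ = proj₂ (proj₂ (proj₂ (point-over y σ)))

    α : G.Carrier → H.Carrier
    α y = value-of (over y Bitsₙ.ε)

    α-cong : ∀ {x y} → x G.≈ y → α x H.≈ α y
    α-cong {x} {y} x≈y = proj₁ (proj₂ (A-determined (over∈A x Bitsₙ.ε) (over∈A y Bitsₙ.ε)
      (G.trans (over-base x Bitsₙ.ε) (G.trans x≈y (G.sym (over-base y Bitsₙ.ε))))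
      (Bitsₙ.trans (over-tags x Bitsₙ.ε) (Bitsₙ.sym (over-tags y Bitsₙ.ε)))))

    A-value : ∀ {a} k → A a → tags-of a Bitsₙ.≈ δ k → value-of a H.≈ α (proj₁ a)
    A-value {a} k a∈A σ≈δ = H.sym (flip-invariant k (over∈A (proj₁ a) Bitsₙ.ε) a∈A
                                  (over-base (proj₁ a) Bitsₙ.ε) (over-tags (proj₁ a) Bitsₙ.ε) σ≈δ)

    translate-sum : ∀ {i j e e∈ x w} → w H.≈ α (x G.∙ h i j) H.∙ e →
                    (x , w , Bitsₙ.ε , marker (eqn i)) G×H′.≈
                    over (x G.∙ h i j) (δ (tag i j)) G×H′.∙ ⟦ equation i j e e∈ ⟧ᵖ
    translate-sum {i} {j} {x = x} w≈ =
      G.trans (G.sym (Gₚ.//-rightDividesʳ (h i j) x)) (G.∙-congʳ (G.sym (over-base y t))) ,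
      H.trans w≈ (H.∙-congʳ (H.sym (H.trans (A-value (tag i j) (over∈A y t) (over-tags y t))
                                            (α-cong (over-base y t))))) ,
      Bitsₙ.sym (Bitsₙ.trans (Bitsₙ.∙-congʳ (over-tags y t)) (Bitsₙ.inverseʳ t)) ,
      Marker.sym (Marker.trans (Marker.∙-congʳ (A-normal (over∈A y t))) (Marker.identityˡ (marker (eqn i))))
      where
      y : G.Carrier
      y = x G.∙ h i j
      t : Bitsₙ.Carrier
      t = δ (tag i j)

    α-obeys : Obeys G H S α
    α-obeys i x = disjoint , covers
      where
      disjoint : ∀ j j′ → ¬ j ≡ j′ → ∀ w →
                 ¬ (InTranslate G H α x (h i j) (E i j) w × InTranslate G H α x (h i j′) (E i j′) w)
      disjoint j j′ j≢j′ w ((e , e∈ , w≈) , (e′ , e′∈ , w≈′)) =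
        j≢j′ (tag-injective (δ-injective (tags-of-cong (proj₂
          (unique-sum (equation i j e e∈) (equation i j′ e′ e′∈)
            (over∈A (x G.∙ h i j) (δ (tag i j))) (over∈A (x G.∙ h i j′) (δ (tag i j′)))
            (G×H′.trans (G×H′.sym (translate-sum {e∈ = e∈} w≈)) (translate-sum {e∈ = e′∈} w≈′)))))))

      translate-of : ∀ {a w} p → shape p ≡ eqn i → A a →
                     (x , w , Bitsₙ.ε , marker (eqn i)) G×H′.≈ a G×H′.∙ ⟦ p ⟧ᵖ →
                     Σ (Fin (J i)) λ j → InTranslate G H α x (h i j) (E i j) w
      translate-of {a} (equation _ j e e∈) refl a∈A (x≈ , w≈ , ε≈ , _) =
        j , e , e∈ , H.trans w≈ (H.∙-congʳ (H.trans (A-value (tag i j) a∈A σ≈δ) (α-cong xₐ≈)))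
        where
        σ≈δ : tags-of a Bitsₙ.≈ δ (tag i j)
        σ≈δ = Bitsₙₚ.inverseˡ-unique (tags-of a) (δ (tag i j)) (Bitsₙ.sym ε≈)
        xₐ≈ : proj₁ a G.≈ x G.∙ h i j
        xₐ≈ = G.trans (G.sym (Gₚ.//-rightDividesˡ (h i j) (proj₁ a))) (G.∙-congʳ (G.sym x≈))
      translate-of (fill _ _)     () _ _
      translate-of (offset _ _ _) () _ _
      translate-of (flip _)       () _ _

      covers : ∀ w → _∈ₛ_ H w (E′ i) ⇔ (Σ (Fin (J i)) λ j → InTranslate G H α x (h i j) (E i j) w)
      covers w = mk⇔ to from
        where
        to : _∈ₛ_ H w (E′ i) → Σ (Fin (J i)) λ j → InTranslate G H α x (h i j) (E i j) w
        to w∈ = let a , p , a∈A , e = decompose x (layer (eqn i) w w∈ Bitsₙ.ε)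
                in translate-of p (covering-shape {s = eqn i} a∈A e) a∈A e

        from : (Σ (Fin (J i)) λ j → InTranslate G H α x (h i j) (E i j) w) → _∈ₛ_ H w (E′ i)
        from (j , e , e∈ , w≈) = admissible-in-region
          (Equivalence.from (proj₁ (proj₂ tiling) (x , w , Bitsₙ.ε , marker (eqn i)))
            (over (x G.∙ h i j) (δ (tag i j)) , ⟦ equation i j e e∈ ⟧ᵖ , over∈A (x G.∙ h i j) (δ (tag i j)) ,
             ∈tile⁺ (equation i j e e∈) G×H′.refl , translate-sum {e∈ = e∈} w≈))

    satisfiable : Satisfiable G H S
    satisfiable = record { fun = α ; cong = α-cong } , α-obeys

  module FromSolution (α-map : Map G H) (α-obeys : Obeys G H S (Map.fun α-map)) where
    α : G.Carrier → H.Carrier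
    α = Map.fun α-map

    OnGraph : Point → Set d
    OnGraph z = (value-of z H.≈ α (proj₁ z)) × (marker-of z Marker.≈ Marker.ε)

    graph-point : G.Carrier → Bitsₙ.Carrier → Point
    graph-point x σ = x , α x , σ , Marker.ε

    graph-sum : ∀ {y w σ s} x σ′ p → s ≡ shape p → y G.≈ x G.∙ position p → w H.≈ α x H.∙ value p →
                σ Bitsₙ.≈ σ′ Bitsₙ.∙ tags p →
                (y , w , σ , marker s) G×H′.≈ graph-point x σ′ G×H′.∙ ⟦ p ⟧ᵖ
    graph-sum _ _ p refl y≈ w≈ σ≈ = y≈ , w≈ , σ≈ , Marker.sym (Marker.identityˡ (marker (shape p)))

    decompose : ∀ y L → CoveredBy OnGraph (y , ⟦ L ⟧ˡ)
    decompose y (layer (main b) w _ σ) =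
      graph-point y σ , p , (H.refl , Marker.refl) ,
      graph-sum y σ p refl (G.sym (G.identityʳ y)) (H.sym (Hₚ.\\-leftDividesˡ (α y) w))
        (Bitsₙ.sym (Bitsₙ.identityʳ σ))
      where
      p : Piece
      p = fill (α y H.⁻¹ H.∙ w) b
    decompose y (layer (eqn i) w w∈ σ) =
      let j , e , e∈ , w≈ = Equivalence.to (proj₂ (α-obeys i y) w) w∈
          p = equation i j e e∈
          σ′ = σ Bitsₙ.∙ δ (tag i j)
      in graph-point (y G.∙ h i j) σ′ , p , (H.refl , Marker.refl) ,
         graph-sum (y G.∙ h i j) σ′ p refl (G.sym (Gₚ.//-rightDividesʳ (h i j) y)) w≈
           (Bitsₙ.sym (Bitsₙₚ.//-rightDividesʳ (δ (tag i j)) σ))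
    decompose y (layer (key k) w _ σ) = by-cases (H? w (α y))
      where
      by-cases : Dec (w H.≈ α y) → CoveredBy OnGraph (y , w , σ , marker (key k))
      by-cases (yes w≈) =
        graph-point y (σ Bitsₙ.∙ δ k) , flip k , (H.refl , Marker.refl) ,
        graph-sum y (σ Bitsₙ.∙ δ k) (flip k) refl (G.sym (G.identityʳ y))
          (H.trans w≈ (H.sym (H.identityʳ (α y)))) (Bitsₙ.sym (Bitsₙₚ.//-rightDividesʳ (δ k) σ))
      by-cases (no w≉) =
        graph-point y σ , p , (H.refl , Marker.refl) ,
        graph-sum y σ p refl (G.sym (G.identityʳ y)) (H.sym (Hₚ.\\-leftDividesˡ (α y) w))
          (Bitsₙ.sym (Bitsₙ.identityʳ σ))
        where
        p : Piece
        p = offset k (α y H.⁻¹ H.∙ w) (w≉ ∘ H.sym ∘ ⁻¹∙≈ε⇒≈ H.group)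

    sum-admissible : ∀ {a} → OnGraph a → ∀ p → Admissible (shape p) (value-of a H.∙ value p)
    sum-admissible _ (fill _ _) = tt
    sum-admissible {a} (w≈ , _) (equation i j e e∈) =
      admissible-resp (eqn i) (H.∙-congʳ (H.sym w≈))
        (Equivalence.from (proj₂ (α-obeys i (proj₁ a G.∙ h i j G.⁻¹)) _)
          (j , e , e∈ , H.∙-congʳ (Map.cong α-map (G.sym (Gₚ.//-rightDividesˡ (h i j) (proj₁ a))))))
    sum-admissible _ (offset _ _ _) = tt
    sum-admissible _ (flip _) = tt

    graph-points-agree : ∀ {a a′} → OnGraph a → OnGraph a′ → proj₁ a G.≈ proj₁ a′ →
                         tags-of a Bitsₙ.≈ tags-of a′ → a G×H′.≈ a′
    graph-points-agree (w≈ , m≈ε) (w′≈ , m′≈ε) x≈x′ σ≈σ′ =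
      x≈x′ , H.trans w≈ (H.trans (Map.cong α-map x≈x′) (H.sym w′≈)) , σ≈σ′ ,
      Marker.trans m≈ε (Marker.sym m′≈ε)

    offset-flip-disjoint : ∀ a a′ {k v v≉ε k′} → OnGraph a → OnGraph a′ →
                           ¬ (a G×H′.∙ ⟦ offset k v v≉ε ⟧ᵖ G×H′.≈ a′ G×H′.∙ ⟦ flip k′ ⟧ᵖ)
    offset-flip-disjoint (xₐ , wₐ , _) (xₐ′ , wₐ′ , _) {v = v} {v≉ε} (w≈ , _) (w′≈ , _) (x≈ , v≈ , _) =
      v≉ε (Hₚ.∙-cancelˡ wₐ v H.ε (H.trans v≈ (H.∙-congʳ wₐ′≈wₐ)))
      where
      wₐ′≈wₐ : wₐ′ H.≈ wₐ
      wₐ′≈wₐ = H.trans w′≈ (H.trans (Map.cong α-map (G.sym (Gₚ.∙-cancelʳ G.ε xₐ xₐ′ x≈))) (H.sym w≈))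

    pieces-agree : ∀ {a a′} → OnGraph a → OnGraph a′ → ∀ p p′ → shape p ≡ shape p′ →
                   a G×H′.∙ ⟦ p ⟧ᵖ G×H′.≈ a′ G×H′.∙ ⟦ p′ ⟧ᵖ →
                   (position p G.≈ position p′) × (tags p Bitsₙ.≈ tags p′)
    pieces-agree _ _ (fill _ _) (fill _ _) _ _ = G.refl , Bitsₙ.refl
    pieces-agree {x , _} {x′ , _} (w≈ , _) (w′≈ , _) (equation i j e e∈) (equation _ j′ e′ e′∈) refl
                 (x≈ , v≈ , _) with j Finₚ.≟ j′
    ... | yes refl = G.refl , Bitsₙ.refl
    ... | no j≢j′  = ⊥-elim (proj₁ (α-obeys i y) j j′ j≢j′ (α x H.∙ e) (in-translate , in-translate′))
      where
      y : G.Carrier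
      y = x G.∙ h i j G.⁻¹
      in-translate : InTranslate G H α y (h i j) (E i j) (α x H.∙ e)
      in-translate = e , e∈ , H.∙-congʳ (Map.cong α-map (G.sym (Gₚ.//-rightDividesˡ (h i j) x)))
      x′≈ : x′ G.≈ y G.∙ h i j′
      x′≈ = G.trans (G.sym (Gₚ.//-rightDividesˡ (h i j′) x′)) (G.∙-congʳ (G.sym x≈))
      in-translate′ : InTranslate G H α y (h i j′) (E i j′) (α x H.∙ e)
      in-translate′ = e′ , e′∈ ,
        H.trans (H.∙-congʳ (H.sym w≈)) (H.trans v≈ (H.∙-congʳ (H.trans w′≈ (Map.cong α-map x′≈))))
    pieces-agree _ _ (offset _ _ _) (offset _ _ _) refl _ = G.refl , Bitsₙ.refl
    pieces-agree {a} {a′} a-on a′-on (offset k v v≉ε) (flip _) refl sum≈ =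
      ⊥-elim (offset-flip-disjoint a a′ {k} {v} {v≉ε} {k} a-on a′-on sum≈)
    pieces-agree {a} {a′} a-on a′-on (flip k) (offset _ v v≉ε) refl sum≈ =
      ⊥-elim (offset-flip-disjoint a′ a {k} {v} {v≉ε} {k} a′-on a-on (G×H′.sym sum≈))
    pieces-agree _ _ (flip _) (flip _) refl _ = G.refl , Bitsₙ.refl
    pieces-agree _ _ (fill _ _)         (equation _ _ _ _) () _
    pieces-agree _ _ (fill _ _)         (offset _ _ _)     () _
    pieces-agree _ _ (fill _ _)         (flip _)           () _
    pieces-agree _ _ (equation _ _ _ _) (fill _ _)         () _
    pieces-agree _ _ (equation _ _ _ _) (offset _ _ _)     () _
    pieces-agree _ _ (equation _ _ _ _) (flip _)           () _
    pieces-agree _ _ (offset _ _ _)     (fill _ _)         () _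
    pieces-agree _ _ (offset _ _ _)     (equation _ _ _ _) () _
    pieces-agree _ _ (flip _)           (fill _ _)         () _
    pieces-agree _ _ (flip _)           (equation _ _ _ _) () _

    A : Point → Set (a ⊔ˡ b ⊔ˡ c ⊔ˡ d)
    A z = Lift (a ⊔ˡ b ⊔ˡ c ⊔ˡ d) (OnGraph z)

    covered : ∀ z → _∈ₛ_ H′ (proj₂ z) region ⇔
                    (Σ Point λ a → Σ Point λ f → A a × _∈F_ G H′ f tile × (z G×H′.≈ a G×H′.∙ f))
    covered (y , q) = mk⇔ to from
      where
      to : _∈ₛ_ H′ q region →
           Σ Point λ a → Σ Point λ f → A a × _∈F_ G H′ f tile × ((y , q) G×H′.≈ a G×H′.∙ f)
      to q∈ = let L , q≈L = ∈region⁻ q∈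
                  a , p , a-on , e = decompose y L
              in a , ⟦ p ⟧ᵖ , lift a-on , ∈tile⁺ p G×H′.refl , G×H′.trans (G.refl , q≈L) e

      from : (Σ Point λ a → Σ Point λ f → A a × _∈F_ G H′ f tile × ((y , q) G×H′.≈ a G×H′.∙ f)) →
             _∈ₛ_ H′ q region
      from (a , f , lift a-on , f∈ , z≈) =
        let p , f≈p = ∈tile⁻ f∈
        in ∈region⁺ (layer (shape p) (value-of a H.∙ value p) (sum-admissible {a} a-on p)
                            (tags-of a Bitsₙ.∙ tags p))
             (H′.trans (proj₂ z≈) (H′.trans (H′.∙-congˡ {proj₂ a} (proj₂ f≈p))
               (H.refl , Bitsₙ.refl ,
                Marker.trans (Marker.∙-congʳ (proj₂ a-on)) (Marker.identityˡ (marker (shape p))))))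

    unique : ∀ a a′ f f′ → A a → A a′ → _∈F_ G H′ f tile → _∈F_ G H′ f′ tile →
             a G×H′.∙ f G×H′.≈ a′ G×H′.∙ f′ → (a G×H′.≈ a′) × (f G×H′.≈ f′)
    unique a a′ f f′ (lift a-on) (lift a′-on) f∈ f′∈ sum≈ = a≈a′ , G×H′ₚ.∙-cancelˡ a f f′
                                                            (G×H′.trans sum≈ (G×H′.∙-congʳ (G×H′.sym a≈a′)))
      where
      p p′ : Piece
      p = proj₁ (∈tile⁻ f∈)
      p′ = proj₁ (∈tile⁻ f′∈)
      sum≈′ : a G×H′.∙ ⟦ p ⟧ᵖ G×H′.≈ a′ G×H′.∙ ⟦ p′ ⟧ᵖ
      sum≈′ = G×H′.trans (G×H′.∙-congˡ {a} (G×H′.sym (proj₂ (∈tile⁻ f∈))))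
                (G×H′.trans sum≈ (G×H′.∙-congˡ {a′} (proj₂ (∈tile⁻ f′∈))))
      agree : (position p G.≈ position p′) × (tags p Bitsₙ.≈ tags p′)
      agree = pieces-agree {a} {a′} a-on a′-on p p′
                (marker-cancel (proj₂ a-on) (proj₂ a′-on) (proj₂ (proj₂ (proj₂ sum≈′)))) sum≈′
      a≈a′ : a G×H′.≈ a′
      a≈a′ = graph-points-agree {a} {a′} a-on a′-on
        (Gₚ.∙-cancelʳ (position p) (proj₁ a) (proj₁ a′)
          (G.trans (proj₁ sum≈′) (G.∙-congˡ {proj₁ a′} (G.sym (proj₁ agree)))))
        (Bitsₙₚ.∙-cancelʳ (tags p) (tags-of a) (tags-of a′)
          (Bitsₙ.trans (proj₁ (proj₂ (proj₂ sum≈′))) (Bitsₙ.∙-congˡ {tags-of a′} (Bitsₙ.sym (proj₂ agree)))))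

    tiling : Tiles G H′ tile region
    tiling = A , covered , unique

  reduction : TilingReduction G c d (Satisfiable G H S)
  reduction = H′ , isFinite-H′ , region , tile ,
              mk⇔ FromTiling.satisfiable (λ (α , α-obeys) → FromSolution.tiling α α-obeys)

open Construction using (reduction)

proposition6p3 : ∀ {a b c d : Level} (G : AbelianGroup a b) → FinitelyGenerated G →
    -- (i) a finite abelian group H and a witnessing system for P
    ((H : AbelianGroup c d) → IsFinite H → (S : System G H) →
      TilingReduction G c d (Satisfiable G H S))
    ×
    -- (ii) a finite family (H_u)_{u ∈ U}, U = Fin k, and a witnessing system
    -- for the corresponding (G, ∏_u H_u)-property
    ((k : ℕ) (H : Fin k → AbelianGroup c d) → (∀ u → IsFinite (H u)) →
      (S : System G (ΠGroup H)) →
      TilingReduction G c d (Satisfiable G (ΠGroup H) S))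
    ×
    -- (iii) P the existential quantification of an expressible property P*
    -- on (H_u)_{u ∈ U ⊎ U*}, given with its witnessing system S*
    ((k k* : ℕ) (H : Fin k → AbelianGroup c d) (H* : Fin k* → AbelianGroup c d) →
      (∀ u → IsFinite (H u)) → (∀ u → IsFinite (H* u)) →
      (S* : System G (ΠGroup (joinFam G H H*))) →
      TilingReduction G c d (WeaklySatisfiable G H H* S*))
-- Finite generation of G only matters for the construction to be effective.
proposition6p3 G _ =
  (λ H finite S → reduction G H finite S) ,
  (λ k H finite S → reduction G (ΠGroup H) (isFinite-Π-Fin k H finite) S) ,
  (λ k k* H H* finite finite* S* →
     TilingReduction-resp G
       (reduction G (ΠGroup (joinFam G H H*))
          (isFinite-Π-⊎ (joinFam G H H*) (isFinite-Π-Fin k H finite) (isFinite-Π-Fin k* H* finite*)) S*)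
       (satisfiable⇔weaklySatisfiable G H H* S*))
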